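{- Let $i,j,k$ be nonnegative integers and $n=i+j+k+6$. Let $I=(K_n,c)$ be a \textsc{Metric TSP} instance (with $OPT_{LP}(I)>0$) such that an optimal solution of the subtour LP of $I$ is isomorphic to $x_{i,j,k}$. Then $$\frac{OPT(I)}{OPT_{LP}(I)}\le 1+\frac{1}{3+2\left(\frac{1}{i+1}+\frac{1}{j+1}+\frac{1}{k+1}\right)}.$$
   Context: A \textsc{Metric TSP} instance is a complete graph $K_n$ with nonnegative edge costs $c$ satisfying the triangle inequality. $OPT(I)$ is the minimum cost of a Hamiltonian cycle; $OPT_{LP}(I)$ is the optimal value of the subtour LP: minimize $\sum_e c(e)x_e$ subject to $\sum_{e\in\delta(v)}x_e=2$ for all $v$, $\sum_{e\in\delta(X)}x_e\ge2$ for all $\emptyset\ne X\subsetneq V(K_n)$, $0\le x_e\le 1$. The weighted graph $x_{i,j,k}$ has vertex set $\{X_0,\dots,X_{i+1},Y_0,\dots,Y_{j+1},Z_0,\dots,Z_{k+1}\}$; the edges $\{X_r,X_{r+1}\}$ ($0\le r\le i$), $\{Y_s,Y_{s+1}\}$ ($0\le s\le j$), $\{Z_t,Z_{t+1}\}$ ($0\le t\le k$) have weight $1$; the edges $\{X_0,Y_0\},\{X_0,Z_0\},\{Y_0,Z_0\},\{X_{i+1},Y_{j+1}\},\{X_{i+1},Z_{k+1}\},\{Y_{j+1},Z_{k+1}\}$ have weight $\frac12$; all other pairs have weight $0$. A vector $x\in\mathbb{R}^{E(K_n)}$ is isomorphic to $x_{i,j,k}$ if there is a bijection $\varphi:V(K_n)\to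 V(x_{i,j,k})$ with $x(\{u,v\})$ equal to the weight of $\{\varphi(u),\varphi(v)\}$ for all $u\ne v$.
   Formalization: The edge costs c and the subtour LP vectors, both the optimal solution and the feasible points it is compared with, take values in ℚ rather than ℝ. -}

module Defs where

open import Data.Nat as ℕ using (ℕ; zero; suc)
open import Data.Integer using (+_)
open import Data.Fin using (Fin; zero; suc; toℕ; fromℕ<; _≟_)
open import Data.Fin.Subset using (Subset; Side; inside; outside; Nonempty; _∉_)
open import Data.Vec using (lookup)
open import Data.Bool using (Bool; true; false; if_then_else_; _∧_; _∨_)
open import Data.Product using (_×_; Σ; ∃)
open import Data.Sum using (_⊎_; inj₁; inj₂)
open import Function.Bundles using (_⤖_; Bijection)
open import Relation.Nullary using (¬_; yes; no)
open import Relation.Nullary.Decidable using (⌊_⌋)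
open import Relation.Binary.PropositionalEquality using (_≡_)
open import Data.Rational using (ℚ; 0ℚ; 1ℚ; ½; _+_; _*_; _≤_; _<_; _/_; 1/_; NonZero; Positive; NonNegative)
open import Data.Rational.Properties using (pos⇒nonZero; pos+nonNeg⇒pos; nonNeg+nonNeg⇒nonNeg; nonNeg*nonNeg⇒nonNeg; normalize-nonNeg)

Σ[_] : ∀ {n} → (Fin n → ℚ) → ℚ
Σ[_] {zero}  f = 0ℚ
Σ[_] {suc n} f = f zero + Σ[_] {n} (λ t → f (suc t))

[_]ᵇ : Bool → ℚ
[ true ]ᵇ  = 1ℚ
[ false ]ᵇ = 0ℚ

-- Metric TSP instances on K_n (vertex set Fin n).  An edge {u,v} (u ≢ v)
-- has cost c u v; the diagonal c u u is irrelevant (K_n has no loops).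

record IsMetricCost (n : ℕ) (c : Fin n → Fin n → ℚ) : Set where
  field
    symmetric   : ∀ u v → c u v ≡ c v u
    nonnegative : ∀ u v → ¬ u ≡ v → 0ℚ ≤ c u v
    triangle    : ∀ u v w → ¬ u ≡ v → ¬ v ≡ w → ¬ u ≡ w →
                  c u w ≤ c u v + c v w

-- cost c·x = Σ_{e ∈ E(K_n)} c(e) x_e, each edge {u,v} counted once (u < v)
linCost : ∀ {n} → (Fin n → Fin n → ℚ) → (Fin n → Fin n → ℚ) → ℚ
linCost c x = Σ[ (λ u → Σ[ (λ v → [ ⌊ toℕ u ℕ.<? toℕ v ⌋ ]ᵇ * (c u v * x u v)) ] ) ]

degree : ∀ {n} → (Fin n → Fin n → ℚ) → Fin n → ℚ
degree x v = Σ[ (λ w → if ⌊ w ≟ v ⌋ then 0ℚ else x v w) ]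

insideᵇ : Side → Bool
insideᵇ inside  = true
insideᵇ outside = false

outsideᵇ : Side → Bool
outsideᵇ inside  = false
outsideᵇ outside = true

cut : ∀ {n} → (Fin n → Fin n → ℚ) → Subset n → ℚ
cut x X = Σ[ (λ u → Σ[ (λ v →
  [ insideᵇ (lookup X u) ∧ outsideᵇ (lookup X v) ]ᵇ * x u v) ]) ]

-- feasible points of the subtour LP (a vector indexed by the edges of K_n,
-- represented as a symmetric function on pairs of distinct vertices)
record SubtourFeasible (n : ℕ) (x : Fin n → Fin n → ℚ) : Set where
  field
    symmetric : ∀ u v → x u v ≡ x v u
    lower     : ∀ u v → ¬ u ≡ v → 0ℚ ≤ x u v
    upper     : ∀ u v → ¬ u ≡ v → x u v ≤ 1ℚ
    degree2   : ∀ v → degree x v ≡ 1ℚ + 1ℚ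
    subtour   : ∀ (X : Subset n) → Nonempty X → Nonempty (Data.Fin.Subset.∁ X) →
                1ℚ + 1ℚ ≤ cut x X

record SubtourOptimal (n : ℕ) (c : Fin n → Fin n → ℚ) (x : Fin n → Fin n → ℚ) : Set where
  field
    feasible : SubtourFeasible n x
    optimal  : ∀ y → SubtourFeasible n y → linCost c x ≤ linCost c y

-- Hamiltonian cycles: a cyclic order σ(0), σ(1), …, σ(n-1) of all vertices

next : ∀ {n} → Fin n → Fin n
next {suc m} t with toℕ t ℕ.<? m
... | yes p = fromℕ< (ℕ.s≤s p)
... | no _  = zero

record HamiltonianCycle (n : ℕ) : Set where
  field
    order : Fin n ⤖ Fin n

tourCost : ∀ {n} → (Fin n → Fin n → ℚ) → HamiltonianCycle n → ℚ
tourCost c H = Σ[ (λ t → c (σ t) (σ (next t))) ]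
  where σ = Bijection.to (HamiltonianCycle.order H)

-- The weighted graph x_{i,j,k}:  vertices X_0..X_{i+1}, Y_0..Y_{j+1}, Z_0..Z_{k+1}

V : ℕ → ℕ → ℕ → Set
V i j k = Fin (suc (suc i)) ⊎ (Fin (suc (suc j)) ⊎ Fin (suc (suc k)))

adj : ∀ {m} → Fin m → Fin m → Bool
adj a b = ⌊ suc (toℕ a) ℕ.≟ toℕ b ⌋ ∨ ⌊ suc (toℕ b) ℕ.≟ toℕ a ⌋

ends : ∀ {p q} → Fin (suc (suc p)) → Fin (suc (suc q)) → Bool
ends {p} {q} a b =
  (⌊ toℕ a ℕ.≟ 0 ⌋ ∧ ⌊ toℕ b ℕ.≟ 0 ⌋) ∨
  (⌊ toℕ a ℕ.≟ suc p ⌋ ∧ ⌊ toℕ b ℕ.≟ suc q ⌋)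

halfIf : Bool → ℚ
halfIf true  = ½
halfIf false = 0ℚ

weight : ∀ i j k → V i j k → V i j k → ℚ
weight i j k (inj₁ a)        (inj₁ b)        = [ adj a b ]ᵇ
weight i j k (inj₂ (inj₁ a)) (inj₂ (inj₁ b)) = [ adj a b ]ᵇ
weight i j k (inj₂ (inj₂ a)) (inj₂ (inj₂ b)) = [ adj a b ]ᵇ
weight i j k (inj₁ a)        (inj₂ (inj₁ b)) = halfIf (ends a b)
weight i j k (inj₂ (inj₁ b)) (inj₁ a)        = halfIf (ends a b)
weight i j k (inj₁ a)        (inj₂ (inj₂ b)) = halfIf (ends a b)
weight i j k (inj₂ (inj₂ b)) (inj₁ a)        = halfIf (ends a b)
weight i j k (inj₂ (inj₁ a)) (inj₂ (inj₂ b)) = halfIf (ends a b)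
weight i j k (inj₂ (inj₂ b)) (inj₂ (inj₁ a)) = halfIf (ends a b)

IsomorphicToXijk : ∀ {n} → (Fin n → Fin n → ℚ) → ℕ → ℕ → ℕ → Set
IsomorphicToXijk {n} x i j k =
  Σ (Fin n ⤖ V i j k) λ φ →
    ∀ u v → ¬ u ≡ v →
      x u v ≡ weight i j k (Bijection.to φ u) (Bijection.to φ v)

inv1+ : ℕ → ℚ
inv1+ m = + 1 / suc m

denom : ℕ → ℕ → ℕ → ℚ
denom i j k = (+ 3 / 1) + (+ 2 / 1) * (inv1+ i + inv1+ j + inv1+ k)

denom-pos : ∀ i j k → Positive (denom i j k)
denom-pos i j k =
  pos+nonNeg⇒pos (+ 3 / 1) {{_}} ((+ 2 / 1) * s) {{nonNeg*nonNeg⇒nonNeg (+ 2 / 1) {{_}} s {{s≥0}}}}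
  where
  s = inv1+ i + inv1+ j + inv1+ k
  ij≥0 : NonNegative (inv1+ i + inv1+ j)
  ij≥0 = nonNeg+nonNeg⇒nonNeg (inv1+ i) {{normalize-nonNeg 1 (suc i)}} (inv1+ j) {{normalize-nonNeg 1 (suc j)}}
  s≥0 : NonNegative s
  s≥0 = nonNeg+nonNeg⇒nonNeg (inv1+ i + inv1+ j) {{ij≥0}} (inv1+ k) {{normalize-nonNeg 1 (suc k)}}

bound : ℕ → ℕ → ℕ → ℚ
bound i j k = 1ℚ + (1/ denom i j k) {{pos⇒nonZero (denom i j k) {{denom-pos i j k}}}}

-- The vertices of x_{i,j,k} form three paths P_X, P_Y, P_Z whose first vertices, and whose last
-- vertices, are pairwise joined by half-edges; so c(x) = L := c(P_X) + c(P_Y) + c(P_Z) + ½ (the six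
-- end edges). Fix a path P, with i+1 edges, and let Q, R be the other two in cyclic order.
-- Shortcutting (triangle inequality) gives two tours that traverse P twice and Q, R once; together
-- they use each end edge once, so their costs sum to at most 2L + 2c(P). A third tour deletes a
-- heaviest edge e ≥ c(P)/(i+1) of P and weaves the two pieces of P through Q and R; its cost plus 2e
-- is at most S_P = 2c(P) + c(Q) + c(R) + the four end edges at P, and S_X + S_Y + S_Z = 4L.
-- Give the two doubled tours of P weight 1/(i+1) each and the third tour weight 1: the nine tours
-- have total weight w = 3 + 2 Σ 1/(i+1) and weighted cost sum at most (w + 1) L, so the cheapest
-- costs at most (1 + 1/w) L. Optimality of x is used only for its symmetry.
module Submission where

open import Defs

import Data.Rational.Properties as QP
open import Algebra.Properties.CommutativeMonoid.Sum QP.+-0-commutativeMonoid using (sum; ∑-permute)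
open import Data.Bool using (Bool; true; false; _∧_; _∨_; if_then_else_)
open import Data.Bool.Properties using (∧-zeroʳ)
open import Data.Empty using (⊥-elim)
open import Data.Fin as Fin using (Fin; zero; suc; toℕ; fromℕ; inject₁; _↑ˡ_; _↑ʳ_)
import Data.Fin.Properties as FinP
open import Data.Fin.Permutation as Perm using (Permutation; _⟨$⟩ʳ_; _⟨$⟩ˡ_)
import Data.Integer as ℤ
import Data.Integer.Tactic.RingSolver as ℤSolver
open import Data.List using (List; []; _∷_; _++_; [_]; length; tabulate; lookup)
import Data.List.Properties as ListP
open import Data.List.Membership.Propositional using (_∈_)
open import Data.List.Membership.Propositional.Properties using (∈-tabulate⁺; ∈-lookup)
open import Data.List.Relation.Binary.Permutation.Propositional
  using (_↭_; ↭-refl; ↭-sym; ↭-trans; ↭-reflexive; prep; ↭⇒↭ₛ)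
import Data.List.Relation.Binary.Permutation.Propositional.Properties as ↭P
import Data.List.Relation.Binary.Permutation.Setoid.Properties as ↭ₛP
open import Data.List.Relation.Unary.All as All using (All; []; _∷_)
import Data.List.Relation.Unary.All.Properties as AllP
open import Data.List.Relation.Unary.AllPairs using (_∷_)
import Data.List.Relation.Unary.Any as Any
import Data.List.Relation.Unary.Any.Properties as AnyP
open import Data.List.Relation.Unary.Unique.Propositional using (Unique)
import Data.List.Relation.Unary.Unique.Propositional.Properties as UniqueP
open import Data.Nat as ℕ using (ℕ; zero; suc)
import Data.Nat.Coprimality as Coprime
import Data.Nat.Properties as ℕP
open import Data.Product using (Σ; ∃; _×_; _,_; proj₁; proj₂)
open import Data.Rational using (ℚ; mkℚ; 0ℚ; 1ℚ; ½; _+_; _*_; _/_; 1/_; _≤_; _<_; nonNegative)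
import Data.Rational.Unnormalised as ℚᵘ
import Data.Rational.Unnormalised.Properties as ℚᵘP
open import Data.Sum using (inj₁; inj₂)
open import Data.Sum.Function.Propositional using (_⊎-↔_)
open import Function using (_∘_)
open import Function.Bundles using (Bijection; Inverse; _↔_; _⤖_; mk⤖)
open import Function.Construct.Identity using (⤖-id)
open import Function.Properties.Bijection using (⤖⇒↔)
open import Function.Properties.Inverse using (↔-refl; ↔-sym; ↔-trans)
open import Relation.Binary.Bundles using (DecTotalOrder)
open import Relation.Binary.PropositionalEquality
  using (_≡_; refl; sym; trans; cong; cong₂; subst; setoid; module ≡-Reasoning)
open import Relation.Nullary using (¬_; Dec; yes; no)
open import Relation.Nullary.Decidable using (⌊_⌋; isYes≗does; dec⇒maybe)
open import Tactic.RingSolver using (solve-∀)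
open import Tactic.RingSolver.Core.AlmostCommutativeRing using (AlmostCommutativeRing; fromCommutativeRing)
open import Data.List.Extrema (DecTotalOrder.totalOrder QP.≤-decTotalOrder) using (argmin; f[argmin]≤f[xs])

ℚ-ring : AlmostCommutativeRing _ _
ℚ-ring = fromCommutativeRing QP.+-*-commutativeRing (λ q → dec⇒maybe (0ℚ QP.≟ q))

Σ-cong : ∀ {n} {f g : Fin n → ℚ} → (∀ t → f t ≡ g t) → Σ[ f ] ≡ Σ[ g ]
Σ-cong {zero}  f≗g = refl
Σ-cong {suc n} f≗g = cong₂ _+_ (f≗g zero) (Σ-cong (f≗g ∘ suc))

Σ-zero : ∀ n → Σ[ (λ (_ : Fin n) → 0ℚ) ] ≡ 0ℚ
Σ-zero zero    = refl
Σ-zero (suc n) = trans (QP.+-identityˡ _) (Σ-zero n)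

Σ-head : ∀ {n} (f : Fin (suc n) → ℚ) → (∀ t → f (suc t) ≡ 0ℚ) → Σ[ f ] ≡ f zero
Σ-head {n} f tail≡0 = trans (cong (f zero +_) (trans (Σ-cong tail≡0) (Σ-zero n))) (QP.+-identityʳ _)

Σ-tail : ∀ {n} (f : Fin (suc n) → ℚ) → f zero ≡ 0ℚ → Σ[ f ] ≡ Σ[ f ∘ suc ]
Σ-tail f f₀≡0 = trans (cong (_+ Σ[ f ∘ suc ]) f₀≡0) (QP.+-identityˡ _)

Σ-distrib-+ : ∀ {n} (f g : Fin n → ℚ) → Σ[ (λ t → f t + g t) ] ≡ Σ[ f ] + Σ[ g ]
Σ-distrib-+ {zero}  f g = refl
Σ-distrib-+ {suc n} f g =
  trans (cong (f zero + g zero +_) (Σ-distrib-+ (f ∘ suc) (g ∘ suc)))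
        (interchange (f zero) (g zero) Σ[ f ∘ suc ] Σ[ g ∘ suc ])
  where
  interchange : ∀ a b c d → (a + b) + (c + d) ≡ (a + c) + (b + d)
  interchange = solve-∀ ℚ-ring

*-distribˡ-Σ : ∀ {n} k (f : Fin n → ℚ) → k * Σ[ f ] ≡ Σ[ (λ t → k * f t) ]
*-distribˡ-Σ {zero}  k f = QP.*-zeroʳ k
*-distribˡ-Σ {suc n} k f = trans (QP.*-distribˡ-+ k _ _) (cong (k * f zero +_) (*-distribˡ-Σ k (f ∘ suc)))

Σ-comm : ∀ {m n} (f : Fin m → Fin n → ℚ) →
         Σ[ (λ a → Σ[ (λ b → f a b) ]) ] ≡ Σ[ (λ b → Σ[ (λ a → f a b) ]) ]
Σ-comm {zero}  {n} f = sym (Σ-zero n)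
Σ-comm {suc m} {n} f = trans (cong (Σ[ f zero ] +_) (Σ-comm (f ∘ suc)))
                             (sym (Σ-distrib-+ (f zero) _))

Σ-splitAt : ∀ m {n} (f : Fin (m ℕ.+ n) → ℚ) → Σ[ f ] ≡ Σ[ (λ s → f (s ↑ˡ n)) ] + Σ[ (λ t → f (m ↑ʳ t)) ]
Σ-splitAt zero    f = sym (QP.+-identityˡ _)
Σ-splitAt (suc m) f = trans (cong (f zero +_) (Σ-splitAt m (f ∘ suc))) (sym (QP.+-assoc (f zero) _ _))

tabulate-splitAt : ∀ {A : Set} m {n} (f : Fin (m ℕ.+ n) → A) →
  tabulate f ≡ tabulate (λ s → f (s ↑ˡ n)) ++ tabulate (λ t → f (m ↑ʳ t))
tabulate-splitAt zero    f = refl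
tabulate-splitAt (suc m) f = cong (f zero ∷_) (tabulate-splitAt m (f ∘ suc))

Σ-init-last : ∀ {m} (f : Fin (suc m) → ℚ) → Σ[ f ] ≡ Σ[ (λ t → f (inject₁ t)) ] + f (fromℕ m)
Σ-init-last {zero}  f = trans (QP.+-identityʳ (f zero)) (sym (QP.+-identityˡ (f zero)))
Σ-init-last {suc m} f = trans (cong (f zero +_) (Σ-init-last (f ∘ suc))) (sym (QP.+-assoc (f zero) _ _))

Σ-cast : ∀ {m n} (e : m ≡ n) (f : Fin n → ℚ) → Σ[ f ] ≡ Σ[ f ∘ Fin.cast e ]
Σ-cast refl f = Σ-cong (λ t → cong f (sym (FinP.cast-is-id refl t)))

Σ≡sum : ∀ {n} (f : Fin n → ℚ) → Σ[ f ] ≡ sum f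
Σ≡sum {zero}  f = refl
Σ≡sum {suc n} f = cong (f zero +_) (Σ≡sum (f ∘ suc))

Σ-permute : ∀ {m n} (f : Fin n → ℚ) (π : Permutation m n) → Σ[ f ] ≡ Σ[ (λ s → f (π ⟨$⟩ʳ s)) ]
Σ-permute f π = trans (Σ≡sum f) (trans (∑-permute f π) (sym (Σ≡sum (λ s → f (π ⟨$⟩ʳ s)))))

Σ₂-distrib-+ : ∀ {m n} (f g : Fin m → Fin n → ℚ) →
  Σ[ (λ a → Σ[ (λ b → f a b + g a b) ]) ] ≡ Σ[ (λ a → Σ[ f a ]) ] + Σ[ (λ a → Σ[ g a ]) ]
Σ₂-distrib-+ f g = trans (Σ-cong (λ a → Σ-distrib-+ (f a) (g a))) (Σ-distrib-+ (λ a → Σ[ f a ]) (λ a → Σ[ g a ]))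

≟-suc : ∀ m n → ⌊ suc m ℕ.≟ suc n ⌋ ≡ ⌊ m ℕ.≟ n ⌋
≟-suc m n = trans (isYes≗does (suc m ℕ.≟ suc n)) (sym (isYes≗does (m ℕ.≟ n)))

[]ᵇ-∨ : ∀ x y → x ∧ y ≡ false → [ x ∨ y ]ᵇ ≡ [ x ]ᵇ + [ y ]ᵇ
[]ᵇ-∨ true  false _ = refl
[]ᵇ-∨ false true  _ = refl
[]ᵇ-∨ false false _ = refl

[]ᵇ-∧ : ∀ x y v → [ x ∧ y ]ᵇ * v ≡ [ x ]ᵇ * ([ y ]ᵇ * v)
[]ᵇ-∧ true  y v = sym (QP.*-identityˡ ([ y ]ᵇ * v))
[]ᵇ-∧ false y v = trans (QP.*-zeroˡ v) (sym (QP.*-zeroˡ ([ y ]ᵇ * v)))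

halfIf-∨ : ∀ x y → x ∧ y ≡ false → halfIf (x ∨ y) ≡ ½ * [ x ]ᵇ + ½ * [ y ]ᵇ
halfIf-∨ true  false _ = refl
halfIf-∨ false true  _ = refl
halfIf-∨ false false _ = refl

Σ-pick-zero : ∀ {n} (f : Fin (suc n) → ℚ) → Σ[ (λ a → [ ⌊ toℕ a ℕ.≟ 0 ⌋ ]ᵇ * f a) ] ≡ f zero
Σ-pick-zero f =
  trans (Σ-head (λ a → [ ⌊ toℕ a ℕ.≟ 0 ⌋ ]ᵇ * f a) (λ t → QP.*-zeroˡ (f (suc t)))) (QP.*-identityˡ (f zero))

Σ-pick-last : ∀ n (f : Fin (suc n) → ℚ) → Σ[ (λ a → [ ⌊ toℕ a ℕ.≟ n ⌋ ]ᵇ * f a) ] ≡ f (fromℕ n)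
Σ-pick-last zero    f = Σ-pick-zero f
Σ-pick-last (suc n) f = trans (Σ-tail (λ a → [ ⌊ toℕ a ℕ.≟ suc n ⌋ ]ᵇ * f a) (QP.*-zeroˡ (f zero))) (trans
  (Σ-cong (λ t → cong (λ b → [ b ]ᵇ * f (suc t)) (≟-suc (toℕ t) n))) (Σ-pick-last n (f ∘ suc)))

adj-disjoint : ∀ m n → ⌊ suc m ℕ.≟ n ⌋ ∧ ⌊ suc n ℕ.≟ m ⌋ ≡ false
adj-disjoint m       zero    = refl
adj-disjoint zero    (suc n) = ∧-zeroʳ ⌊ 1 ℕ.≟ suc n ⌋
adj-disjoint (suc m) (suc n) = trans (cong₂ _∧_ (≟-suc (suc m) n) (≟-suc (suc n) m)) (adj-disjoint m n)

ends-disjoint : ∀ a p b₀ bₗ → (⌊ a ℕ.≟ 0 ⌋ ∧ b₀) ∧ (⌊ a ℕ.≟ suc p ⌋ ∧ bₗ) ≡ false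
ends-disjoint zero    p b₀ bₗ = ∧-zeroʳ b₀
ends-disjoint (suc a) p b₀ bₗ = refl

Σ-ends : ∀ {p q} (h : Fin (suc (suc p)) → Fin (suc (suc q)) → ℚ) →
  Σ[ (λ a → Σ[ (λ b → halfIf (ends a b) * h a b) ]) ] ≡ ½ * h zero zero + ½ * h (fromℕ (suc p)) (fromℕ (suc q))
Σ-ends {p} {q} h = begin
  Σ[ (λ a → Σ[ (λ b → halfIf (ends a b) * h a b) ]) ]
    ≡⟨ Σ-cong (λ a → Σ-cong (split a)) ⟩
  Σ[ (λ a → Σ[ (λ b → corner F₀ L₀ a b + corner F₁ L₁ a b) ]) ]
    ≡⟨ Σ₂-distrib-+ (corner F₀ L₀) (corner F₁ L₁) ⟩
  Σ[ (λ a → Σ[ corner F₀ L₀ a ]) ] + Σ[ (λ a → Σ[ corner F₁ L₁ a ]) ]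
    ≡⟨ cong₂ _+_ (Σ-corner F₀ L₀) (Σ-corner F₁ L₁) ⟩
  ½ * picked F₀ L₀ + ½ * picked F₁ L₁
    ≡⟨ cong₂ (λ s t → ½ * s + ½ * t)
         (trans (Σ-cong (λ a → cong ([ F₀ a ]ᵇ *_) (Σ-pick-zero (h a)))) (Σ-pick-zero (λ a → h a zero)))
         (trans (Σ-cong (λ a → cong ([ F₁ a ]ᵇ *_) (Σ-pick-last (suc q) (h a))))
                (Σ-pick-last (suc p) (λ a → h a (fromℕ (suc q))))) ⟩
  ½ * h zero zero + ½ * h (fromℕ (suc p)) (fromℕ (suc q)) ∎
  where
  open ≡-Reasoning
  F₀ F₁ : Fin (suc (suc p)) → Bool
  F₀ a = ⌊ toℕ a ℕ.≟ 0 ⌋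
  F₁ a = ⌊ toℕ a ℕ.≟ suc p ⌋
  L₀ L₁ : Fin (suc (suc q)) → Bool
  L₀ b = ⌊ toℕ b ℕ.≟ 0 ⌋
  L₁ b = ⌊ toℕ b ℕ.≟ suc q ⌋
  corner : (Fin (suc (suc p)) → Bool) → (Fin (suc (suc q)) → Bool) → Fin (suc (suc p)) → Fin (suc (suc q)) → ℚ
  corner F L a b = ½ * ([ F a ]ᵇ * ([ L b ]ᵇ * h a b))
  picked : (Fin (suc (suc p)) → Bool) → (Fin (suc (suc q)) → Bool) → ℚ
  picked F L = Σ[ (λ a → [ F a ]ᵇ * Σ[ (λ b → [ L b ]ᵇ * h a b) ]) ]
  half-distrib : ∀ x y v → (½ * x + ½ * y) * v ≡ ½ * (x * v) + ½ * (y * v)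
  half-distrib = solve-∀ ℚ-ring
  split : ∀ a b → halfIf (ends a b) * h a b ≡ corner F₀ L₀ a b + corner F₁ L₁ a b
  split a b = trans (cong (_* h a b) (halfIf-∨ (F₀ a ∧ L₀ b) (F₁ a ∧ L₁ b) (ends-disjoint (toℕ a) p (L₀ b) (L₁ b))))
    (trans (half-distrib [ F₀ a ∧ L₀ b ]ᵇ [ F₁ a ∧ L₁ b ]ᵇ (h a b))
      (cong₂ (λ s t → ½ * s + ½ * t) ([]ᵇ-∧ (F₀ a) (L₀ b) (h a b)) ([]ᵇ-∧ (F₁ a) (L₁ b) (h a b))))
  Σ-corner : ∀ F L → Σ[ (λ a → Σ[ corner F L a ]) ] ≡ ½ * picked F L
  Σ-corner F L = trans (Σ-cong (λ a → trans (sym (*-distribˡ-Σ ½ (λ b → [ F a ]ᵇ * ([ L b ]ᵇ * h a b))))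
                                            (cong (½ *_) (sym (*-distribˡ-Σ [ F a ]ᵇ (λ b → [ L b ]ᵇ * h a b))))))
                       (sym (*-distribˡ-Σ ½ (λ a → [ F a ]ᵇ * Σ[ (λ b → [ L b ]ᵇ * h a b) ])))

inv1+-nonNeg : ∀ n → 0ℚ ≤ inv1+ n
inv1+-nonNeg n = QP.nonNegative⁻¹ (inv1+ n) {{QP.normalize-nonNeg 1 (suc n)}}

-- By recursion rather than as n / 1, so that toℚ (suc n) = 1 + toℚ n holds definitionally.
toℚ : ℕ → ℚ
toℚ zero    = 0ℚ
toℚ (suc n) = 1ℚ + toℚ n

toℚ-nonNeg : ∀ n → 0ℚ ≤ toℚ n
toℚ-nonNeg zero    = QP.≤-refl
toℚ-nonNeg (suc n) = QP.+-mono-≤ (QP.<⇒≤ (QP.positive⁻¹ 1ℚ)) (toℚ-nonNeg n)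

private
  ⟨_⟩ : ℕ → ℚ
  ⟨ n ⟩ = mkℚ (ℤ.+ n) 0 (Coprime.sym (Coprime.1-coprimeTo n))

  numerators : ∀ m → (ℤ.+ 1 ℤ.* ℤ.+ 1 ℤ.+ m ℤ.* ℤ.+ 1) ℤ.* ℤ.+ 1 ≡ (ℤ.+ 1 ℤ.+ m) ℤ.* ℤ.+ 1
  numerators = ℤSolver.solve-∀

  1+⟨⟩ : ∀ n → 1ℚ + ⟨ n ⟩ ≡ ⟨ suc n ⟩
  1+⟨⟩ n = QP.toℚᵘ-injective (ℚᵘP.≃-trans (QP.toℚᵘ-homo-+ 1ℚ ⟨ n ⟩)
    (ℚᵘ.*≡* (numerators (ℤ.+ n))))

  toℚ≡⟨⟩ : ∀ n → toℚ n ≡ ⟨ n ⟩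
  toℚ≡⟨⟩ zero    = refl
  toℚ≡⟨⟩ (suc n) = trans (cong (λ q → 1ℚ + q) (toℚ≡⟨⟩ n)) (1+⟨⟩ n)

inv1+-*-toℚ : ∀ n → inv1+ n * toℚ (suc n) ≡ 1ℚ
inv1+-*-toℚ n rewrite toℚ≡⟨⟩ (suc n) | QP.normalize-coprime (Coprime.1-coprimeTo (suc n)) = QP.*-inverseˡ ⟨ suc n ⟩

walkEnd : ∀ {A : Set} → A → List A → A
walkEnd x []       = x
walkEnd x (y ∷ ys) = walkEnd y ys

walkEnd-++ : ∀ {A : Set} (x : A) xs y ys → walkEnd x (xs ++ y ∷ ys) ≡ walkEnd y ys
walkEnd-++ x []       y ys = refl
walkEnd-++ x (z ∷ zs) y ys = walkEnd-++ z zs y ys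

pathEnd : ∀ {A : Set} {m} → (Fin (suc m) → A) → A
pathEnd P = walkEnd (P zero) (tabulate (P ∘ suc))

pathEnd-fromℕ : ∀ {A : Set} {m} (P : Fin (suc m) → A) → pathEnd P ≡ P (fromℕ m)
pathEnd-fromℕ {m = zero}  P = refl
pathEnd-fromℕ {m = suc m} P = pathEnd-fromℕ (P ∘ suc)

module Walks {A : Set} (g : A → A → ℚ) where

  walkCost : A → List A → ℚ
  walkCost x []       = 0ℚ
  walkCost x (y ∷ ys) = g x y + walkCost y ys

  closedWalkCost : A → List A → ℚ
  closedWalkCost x xs = walkCost x xs + g (walkEnd x xs) x

  pathCost : ∀ {m} → (Fin (suc m) → A) → ℚ
  pathCost P = walkCost (P zero) (tabulate (P ∘ suc))

  walkCost-++ : ∀ x xs y ys → walkCost x (xs ++ y ∷ ys) ≡ walkCost x xs + g (walkEnd x xs) y + walkCost y ys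
  walkCost-++ x []       y ys = cong (_+ walkCost y ys) (sym (QP.+-identityˡ (g x y)))
  walkCost-++ x (z ∷ zs) y ys = trans (cong (g x z +_) (walkCost-++ z zs y ys))
    (assoc (g x z) (walkCost z zs) (g (walkEnd z zs) y) (walkCost y ys))
    where
    assoc : ∀ a b c d → a + (b + c + d) ≡ a + b + c + d
    assoc = solve-∀ ℚ-ring

  private
    one-more : ∀ e m → e + m * e ≡ (1ℚ + m) * e
    one-more = solve-∀ ℚ-ring

  record HeavyEdge (x : A) (xs : List A) : Set where
    field
      before : List A
      v      : A
      after  : List A
      split  : xs ≡ before ++ v ∷ after
      heavy  : walkCost x xs ≤ toℚ (length xs) * g (walkEnd x before) v

  heavyEdge : ∀ x y ys → HeavyEdge x (y ∷ ys)
  heavyEdge x y [] = record { before = [] ; v = y ; after = [] ; split = refl ;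
    heavy = QP.≤-reflexive (one-edge (g x y)) }
    where
    one-edge : ∀ a → a + 0ℚ ≡ (1ℚ + 0ℚ) * a
    one-edge = solve-∀ ℚ-ring
  heavyEdge x y (z ∷ zs) with heavyEdge y z zs
  ... | e with g x y QP.≤? g (walkEnd y (HeavyEdge.before e)) (HeavyEdge.v e)
  ...   | yes xy≤e = record { before = y ∷ before ; v = v ; after = after ; split = cong (y ∷_) split ;
            heavy = QP.≤-trans (QP.+-mono-≤ xy≤e heavy)
                      (QP.≤-reflexive (one-more (g (walkEnd y before) v) (toℚ (suc (length zs))))) }
    where open HeavyEdge e
  ...   | no xy≰e = record { before = [] ; v = y ; after = z ∷ zs ; split = refl ;
            heavy = QP.≤-trans (QP.+-monoʳ-≤ (g x y) (QP.≤-trans heavy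
                      (QP.*-monoˡ-≤-nonNeg (toℚ (suc (length zs))) {{nonNegative (toℚ-nonNeg (suc (length zs)))}}
                         (QP.<⇒≤ (QP.≰⇒> xy≰e)))))
                    (QP.≤-reflexive (one-more (g x y) (toℚ (suc (length zs))))) }
    where open HeavyEdge e

  average≤heavyEdge : ∀ {x y ys} (h : HeavyEdge x (y ∷ ys)) →
    inv1+ (length ys) * walkCost x (y ∷ ys) ≤ g (walkEnd x (HeavyEdge.before h)) (HeavyEdge.v h)
  average≤heavyEdge {x} {y} {ys} h = begin
    inv1+ n * walkCost x (y ∷ ys) ≤⟨ QP.*-monoˡ-≤-nonNeg (inv1+ n) {{QP.normalize-nonNeg 1 (suc n)}} heavy ⟩
    inv1+ n * (toℚ (suc n) * e)   ≡⟨ sym (QP.*-assoc (inv1+ n) (toℚ (suc n)) e) ⟩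
    inv1+ n * toℚ (suc n) * e     ≡⟨ trans (cong (_* e) (inv1+-*-toℚ n)) (QP.*-identityˡ e) ⟩
    e                             ∎
    where
    open HeavyEdge h
    open QP.≤-Reasoning
    n = length ys
    e = g (walkEnd x before) v

  Σ-consecutive : ∀ {m} (P : Fin (suc m) → A) →
    Σ[ (λ a → Σ[ (λ b → [ ⌊ suc (toℕ a) ℕ.≟ toℕ b ⌋ ]ᵇ * g (P a) (P b)) ]) ] ≡ pathCost P
  Σ-consecutive {zero}  P = trans (QP.+-identityʳ _) (trans (QP.+-identityʳ _) (QP.*-zeroˡ (g (P zero) (P zero))))
  Σ-consecutive {suc m} P = cong₂ _+_ first-row (trans (Σ-cong later-row) (Σ-consecutive (P ∘ suc)))
    where
    first-row : Σ[ (λ b → [ ⌊ 1 ℕ.≟ toℕ b ⌋ ]ᵇ * g (P zero) (P b)) ] ≡ g (P zero) (P (suc zero))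
    first-row = trans (Σ-tail (λ b → [ ⌊ 1 ℕ.≟ toℕ b ⌋ ]ᵇ * g (P zero) (P b)) (QP.*-zeroˡ (g (P zero) (P zero)))) (trans
      (Σ-cong (λ t → cong (λ b → [ b ]ᵇ * g (P zero) (P (suc t))) (≟-suc 0 (toℕ t))))
      (trans (Σ-head (λ t → [ ⌊ 0 ℕ.≟ toℕ t ⌋ ]ᵇ * g (P zero) (P (suc t))) (λ t → QP.*-zeroˡ (g (P zero) (P (suc (suc t))))))
             (QP.*-identityˡ (g (P zero) (P (suc zero))))))
    later-row : ∀ a → Σ[ (λ b → [ ⌊ suc (toℕ (suc a)) ℕ.≟ toℕ b ⌋ ]ᵇ * g (P (suc a)) (P b)) ]
                    ≡ Σ[ (λ b → [ ⌊ suc (toℕ a) ℕ.≟ toℕ b ⌋ ]ᵇ * g (P (suc a)) (P (suc b))) ]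
    later-row a = trans (Σ-tail (λ b → [ ⌊ suc (toℕ (suc a)) ℕ.≟ toℕ b ⌋ ]ᵇ * g (P (suc a)) (P b)) (QP.*-zeroˡ (g (P (suc a)) (P zero))))
      (Σ-cong (λ t → cong (λ b → [ b ]ᵇ * g (P (suc a)) (P (suc t))) (≟-suc (suc (toℕ a)) (toℕ t))))

  module _ (g-sym : ∀ u v → g u v ≡ g v u) where

    Σ-adj : ∀ {m} (P : Fin (suc m) → A) →
      Σ[ (λ a → Σ[ (λ b → [ adj a b ]ᵇ * g (P a) (P b)) ]) ] ≡ pathCost P + pathCost P
    Σ-adj {m} P = begin
      Σ[ (λ a → Σ[ (λ b → [ adj a b ]ᵇ * g (P a) (P b)) ]) ]
        ≡⟨ Σ-cong (λ a → Σ-cong (λ b → trans (cong (_* g (P a) (P b)) ([]ᵇ-∨ (S a b) (S b a) (adj-disjoint (toℕ a) (toℕ b))))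
                                              (QP.*-distribʳ-+ (g (P a) (P b)) [ S a b ]ᵇ [ S b a ]ᵇ))) ⟩
      Σ[ (λ a → Σ[ (λ b → [ S a b ]ᵇ * g (P a) (P b) + [ S b a ]ᵇ * g (P a) (P b)) ]) ]
        ≡⟨ Σ₂-distrib-+ (λ a b → [ S a b ]ᵇ * g (P a) (P b)) (λ a b → [ S b a ]ᵇ * g (P a) (P b)) ⟩
      Σ[ (λ a → Σ[ (λ b → [ S a b ]ᵇ * g (P a) (P b)) ]) ] + Σ[ (λ a → Σ[ (λ b → [ S b a ]ᵇ * g (P a) (P b)) ]) ]
        ≡⟨ cong (Σ[ (λ a → Σ[ (λ b → [ S a b ]ᵇ * g (P a) (P b)) ]) ] +_)
             (trans (Σ-comm (λ a b → [ S b a ]ᵇ * g (P a) (P b)))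
                    (Σ-cong (λ b → Σ-cong (λ a → cong ([ S b a ]ᵇ *_) (g-sym (P a) (P b)))))) ⟩
      Σ[ (λ a → Σ[ (λ b → [ S a b ]ᵇ * g (P a) (P b)) ]) ] + Σ[ (λ b → Σ[ (λ a → [ S b a ]ᵇ * g (P b) (P a)) ]) ]
        ≡⟨ cong₂ _+_ (Σ-consecutive P) (Σ-consecutive P) ⟩
      pathCost P + pathCost P ∎
      where
      open ≡-Reasoning
      S : Fin (suc m) → Fin (suc m) → Bool
      S a b = ⌊ suc (toℕ a) ℕ.≟ toℕ b ⌋

    Σ-ends-symmetric : ∀ {p q} (P : Fin (suc (suc p)) → A) (Q : Fin (suc (suc q)) → A) →
      Σ[ (λ a → Σ[ (λ b → halfIf (ends a b) * g (P a) (Q b)) ]) ] +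
      Σ[ (λ b → Σ[ (λ a → halfIf (ends a b) * g (Q b) (P a)) ]) ]
        ≡ g (P zero) (Q zero) + g (pathEnd P) (pathEnd Q)
    Σ-ends-symmetric {p} {q} P Q = begin
      _ ≡⟨ cong₂ _+_ (Σ-ends (λ a b → g (P a) (Q b)))
                     (trans (sym (Σ-comm (λ a b → halfIf (ends a b) * g (Q b) (P a)))) (Σ-ends (λ a b → g (Q b) (P a)))) ⟩
      ½ * g (P zero) (Q zero) + ½ * g Pₗ Qₗ + (½ * g (Q zero) (P zero) + ½ * g Qₗ Pₗ)
        ≡⟨ cong₂ (λ s t → ½ * g (P zero) (Q zero) + ½ * g Pₗ Qₗ + (½ * s + ½ * t)) (g-sym (Q zero) (P zero)) (g-sym Qₗ Pₗ) ⟩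
      ½ * g (P zero) (Q zero) + ½ * g Pₗ Qₗ + (½ * g (P zero) (Q zero) + ½ * g Pₗ Qₗ)
        ≡⟨ halves (g (P zero) (Q zero)) (g Pₗ Qₗ) ⟩
      g (P zero) (Q zero) + g Pₗ Qₗ
        ≡⟨ cong₂ (λ s t → g (P zero) (Q zero) + g s t) (sym (pathEnd-fromℕ P)) (sym (pathEnd-fromℕ Q)) ⟩
      g (P zero) (Q zero) + g (pathEnd P) (pathEnd Q) ∎
      where
      open ≡-Reasoning
      Pₗ = P (fromℕ (suc p))
      Qₗ = Q (fromℕ (suc q))
      halves : ∀ x y → ½ * x + ½ * y + (½ * x + ½ * y) ≡ x + y
      halves = solve-∀ ℚ-ring

  -- The cost of x_{i,j,k} with its three paths placed along P, Q and R.
  lpValue : ∀ {a b c} → (Fin (suc a) → A) → (Fin (suc b) → A) → (Fin (suc c) → A) → ℚ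
  lpValue P Q R = pathCost P + pathCost Q + pathCost R +
    ½ * (g (P zero) (Q zero) + g (Q zero) (R zero) + g (R zero) (P zero) +
         g (pathEnd P) (pathEnd Q) + g (pathEnd Q) (pathEnd R) + g (pathEnd R) (pathEnd P))

  -- Bounds the cost of the tour built by splitting, plus twice the removed edge.
  splitTourBound : ∀ {a b c} → (Fin (suc a) → A) → (Fin (suc b) → A) → (Fin (suc c) → A) → ℚ
  splitTourBound P Q R = pathCost P + pathCost P + pathCost Q + pathCost R +
    g (P zero) (Q zero) + g (pathEnd P) (pathEnd Q) + g (pathEnd R) (pathEnd P) + g (R zero) (P zero)

  lpValue-rotate : ∀ {a b c} (P : Fin (suc a) → A) (Q : Fin (suc b) → A) (R : Fin (suc c) → A) →
    lpValue Q R P ≡ lpValue P Q R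
  lpValue-rotate P Q R = rotate (pathCost P) (pathCost Q) (pathCost R)
    (g (P zero) (Q zero)) (g (Q zero) (R zero)) (g (R zero) (P zero))
    (g (pathEnd P) (pathEnd Q)) (g (pathEnd Q) (pathEnd R)) (g (pathEnd R) (pathEnd P))
    where
    rotate : ∀ p q r e₁ e₂ e₃ f₁ f₂ f₃ →
      q + r + p + ½ * (e₂ + e₃ + e₁ + f₂ + f₃ + f₁) ≡ p + q + r + ½ * (e₁ + e₂ + e₃ + f₁ + f₂ + f₃)
    rotate = solve-∀ ℚ-ring

  splitTourBound-sum : ∀ {a b c} (P : Fin (suc a) → A) (Q : Fin (suc b) → A) (R : Fin (suc c) → A) →
    splitTourBound P Q R + splitTourBound Q R P + splitTourBound R P Q ≡
    (lpValue P Q R + lpValue P Q R) + (lpValue P Q R + lpValue P Q R)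
  splitTourBound-sum P Q R = four-halves (pathCost P) (pathCost Q) (pathCost R)
    (g (P zero) (Q zero)) (g (Q zero) (R zero)) (g (R zero) (P zero))
    (g (pathEnd P) (pathEnd Q)) (g (pathEnd Q) (pathEnd R)) (g (pathEnd R) (pathEnd P))
    where
    four-halves : ∀ p q r e₁ e₂ e₃ f₁ f₂ f₃ →
      (p + p + q + r + e₁ + f₁ + f₃ + e₃) + (q + q + r + p + e₂ + f₂ + f₁ + e₁) + (r + r + p + q + e₃ + f₃ + f₂ + e₂) ≡
      (p + q + r + ½ * (e₁ + e₂ + e₃ + f₁ + f₂ + f₃) + (p + q + r + ½ * (e₁ + e₂ + e₃ + f₁ + f₂ + f₃))) +
      (p + q + r + ½ * (e₁ + e₂ + e₃ + f₁ + f₂ + f₃) + (p + q + r + ½ * (e₁ + e₂ + e₃ + f₁ + f₂ + f₃)))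
    four-halves = solve-∀ ℚ-ring

Σ-row : ∀ {m a b c} (f₁ : Fin m → Fin a → ℚ) (f₂ : Fin m → Fin b → ℚ) (f₃ : Fin m → Fin c → ℚ) →
  Σ[ (λ r → Σ[ f₁ r ] + (Σ[ f₂ r ] + Σ[ f₃ r ])) ] ≡
  Σ[ (λ r → Σ[ f₁ r ]) ] + (Σ[ (λ r → Σ[ f₂ r ]) ] + Σ[ (λ r → Σ[ f₃ r ]) ])
Σ-row f₁ f₂ f₃ = trans (Σ-distrib-+ (λ r → Σ[ f₁ r ]) (λ r → Σ[ f₂ r ] + Σ[ f₃ r ]))
                      (cong (Σ[ (λ r → Σ[ f₁ r ]) ] +_) (Σ-distrib-+ (λ r → Σ[ f₂ r ]) (λ r → Σ[ f₃ r ])))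

module Vertices (i j k : ℕ) where

  X : Fin (suc (suc i)) → V i j k
  X = inj₁
  Y : Fin (suc (suc j)) → V i j k
  Y = inj₂ ∘ inj₁
  Z : Fin (suc (suc k)) → V i j k
  Z = inj₂ ∘ inj₂

  ΣV : (V i j k → ℚ) → ℚ
  ΣV f = Σ[ f ∘ X ] + (Σ[ f ∘ Y ] + Σ[ f ∘ Z ])

  ΣV-cong : ∀ {f f′ : V i j k → ℚ} → (∀ p → f p ≡ f′ p) → ΣV f ≡ ΣV f′
  ΣV-cong f≗f′ = cong₂ _+_ (Σ-cong (f≗f′ ∘ X)) (cong₂ _+_ (Σ-cong (f≗f′ ∘ Y)) (Σ-cong (f≗f′ ∘ Z)))

  Fin↔V : Fin (suc (suc i) ℕ.+ (suc (suc j) ℕ.+ suc (suc k))) ↔ V i j k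
  Fin↔V = ↔-trans FinP.+↔⊎ (↔-refl ⊎-↔ FinP.+↔⊎)

  toV : Fin (suc (suc i) ℕ.+ (suc (suc j) ℕ.+ suc (suc k))) → V i j k
  toV = Inverse.to Fin↔V

  toV-X : ∀ a → toV (a ↑ˡ _) ≡ X a
  toV-X a = cong (Inverse.to (↔-refl ⊎-↔ FinP.+↔⊎)) (FinP.splitAt-↑ˡ _ a _)

  toV-Y : ∀ b → toV (suc (suc i) ↑ʳ (b ↑ˡ suc (suc k))) ≡ Y b
  toV-Y b = trans (cong (Inverse.to (↔-refl ⊎-↔ FinP.+↔⊎)) (FinP.splitAt-↑ʳ _ _ (b ↑ˡ _)))
                  (cong inj₂ (FinP.splitAt-↑ˡ _ b _))

  toV-Z : ∀ t → toV (suc (suc i) ↑ʳ (suc (suc j) ↑ʳ t)) ≡ Z t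
  toV-Z t = trans (cong (Inverse.to (↔-refl ⊎-↔ FinP.+↔⊎)) (FinP.splitAt-↑ʳ _ _ (suc (suc j) ↑ʳ t)))
                  (cong inj₂ (FinP.splitAt-↑ʳ _ _ t))

  Σ-toV : ∀ f → Σ[ f ∘ toV ] ≡ ΣV f
  Σ-toV f = trans (Σ-splitAt (suc (suc i)) {suc (suc j) ℕ.+ suc (suc k)} (f ∘ toV))
    (cong₂ _+_ (Σ-cong (cong f ∘ toV-X))
      (trans (Σ-splitAt (suc (suc j)) {suc (suc k)} (λ t → f (toV (suc (suc i) ↑ʳ t))))
             (cong₂ _+_ (Σ-cong (cong f ∘ toV-Y)) (Σ-cong (cong f ∘ toV-Z)))))

  tabulate-toV : ∀ {A : Set} (f : V i j k → A) →
    tabulate (f ∘ toV) ≡ tabulate (f ∘ X) ++ tabulate (f ∘ Y) ++ tabulate (f ∘ Z)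
  tabulate-toV f = trans (tabulate-splitAt (suc (suc i)) {suc (suc j) ℕ.+ suc (suc k)} (f ∘ toV))
    (cong₂ _++_ (ListP.tabulate-cong (cong f ∘ toV-X))
      (trans (tabulate-splitAt (suc (suc j)) {suc (suc k)} (λ t → f (toV (suc (suc i) ↑ʳ t))))
             (cong₂ _++_ (ListP.tabulate-cong (cong f ∘ toV-Y)) (ListP.tabulate-cong (cong f ∘ toV-Z)))))

  ΣV-weight : ∀ {A : Set} (g : A → A → ℚ) → (∀ u v → g u v ≡ g v u) → (f : V i j k → A) →
    ΣV (λ p → ΣV (λ q → weight i j k p q * g (f p) (f q))) ≡
    Walks.lpValue g (f ∘ X) (f ∘ Y) (f ∘ Z) + Walks.lpValue g (f ∘ X) (f ∘ Y) (f ∘ Z)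
  ΣV-weight g g-sym f = begin
    ΣV (λ p → ΣV (λ q → W p q))
      ≡⟨ cong₂ _+_ (Σ-row (block X X) (block X Y) (block X Z))
           (cong₂ _+_ (Σ-row (block Y X) (block Y Y) (block Y Z)) (Σ-row (block Z X) (block Z Y) (block Z Z))) ⟩
    B X X + (B X Y + B X Z) + ((B Y X + (B Y Y + B Y Z)) + (B Z X + (B Z Y + B Z Z)))
      ≡⟨ shuffle (B X X) (B X Y) (B X Z) (B Y X) (B Y Y) (B Y Z) (B Z X) (B Z Y) (B Z Z) ⟩
    B X X + B Y Y + B Z Z + (B X Y + B Y X) + (B Y Z + B Z Y) + (B X Z + B Z X)
      ≡⟨ cong₂ _+_ (cong₂ _+_ (cong₂ _+_ (cong₂ _+_ (cong₂ _+_ (Σ-adj g-sym (f ∘ X)) (Σ-adj g-sym (f ∘ Y))) (Σ-adj g-sym (f ∘ Z)))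
                                          (Σ-ends-symmetric g-sym (f ∘ X) (f ∘ Y)))
                              (Σ-ends-symmetric g-sym (f ∘ Y) (f ∘ Z)))
                   (trans (Σ-ends-symmetric g-sym (f ∘ X) (f ∘ Z))
                          (cong₂ _+_ (g-sym (f (X zero)) (f (Z zero))) (g-sym (pathEnd (f ∘ X)) (pathEnd (f ∘ Z))))) ⟩
    (x + x) + (y + y) + (z + z) + (g x₀ y₀ + g xₗ yₗ) + (g y₀ z₀ + g yₗ zₗ) + (g z₀ x₀ + g zₗ xₗ)
      ≡⟨ doubled x y z (g x₀ y₀) (g y₀ z₀) (g z₀ x₀) (g xₗ yₗ) (g yₗ zₗ) (g zₗ xₗ) ⟩
    lpValue (f ∘ X) (f ∘ Y) (f ∘ Z) + lpValue (f ∘ X) (f ∘ Y) (f ∘ Z) ∎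
    where
    open ≡-Reasoning
    open Walks g
    W : V i j k → V i j k → ℚ
    W p q = weight i j k p q * g (f p) (f q)
    block : ∀ {a b} → (Fin a → V i j k) → (Fin b → V i j k) → Fin a → Fin b → ℚ
    block P Q r s = W (P r) (Q s)
    B : ∀ {a b} → (Fin a → V i j k) → (Fin b → V i j k) → ℚ
    B P Q = Σ[ (λ r → Σ[ block P Q r ]) ]
    x = pathCost (f ∘ X)
    y = pathCost (f ∘ Y)
    z = pathCost (f ∘ Z)
    x₀ = f (X zero)
    y₀ = f (Y zero)
    z₀ = f (Z zero)
    xₗ = pathEnd (f ∘ X)
    yₗ = pathEnd (f ∘ Y)
    zₗ = pathEnd (f ∘ Z)
    shuffle : ∀ xx xy xz yx yy yz zx zy zz →
      xx + (xy + xz) + ((yx + (yy + yz)) + (zx + (zy + zz))) ≡ xx + yy + zz + (xy + yx) + (yz + zy) + (xz + zx)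
    shuffle = solve-∀ ℚ-ring
    doubled : ∀ x y z e₁ e₂ e₃ f₁ f₂ f₃ →
      (x + x) + (y + y) + (z + z) + (e₁ + f₁) + (e₂ + f₂) + (e₃ + f₃) ≡
      (x + y + z + ½ * (e₁ + e₂ + e₃ + f₁ + f₂ + f₃)) + (x + y + z + ½ * (e₁ + e₂ + e₃ + f₁ + f₂ + f₃))
    doubled = solve-∀ ℚ-ring

-- The statement leaves the diagonal of c arbitrary; zeroing it gives a cost whose triangle
-- inequality needs no distinctness hypotheses.
offDiagonal : ∀ {n} → (Fin n → Fin n → ℚ) → Fin n → Fin n → ℚ
offDiagonal c u v = if ⌊ u Fin.≟ v ⌋ then 0ℚ else c u v

module _ {n} (c : Fin n → Fin n → ℚ) where

  offDiagonal-diag : ∀ u → offDiagonal c u u ≡ 0ℚ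
  offDiagonal-diag u with u Fin.≟ u
  ... | yes _  = refl
  ... | no u≢u = ⊥-elim (u≢u refl)

  offDiagonal-off : ∀ {u v} → ¬ u ≡ v → offDiagonal c u v ≡ c u v
  offDiagonal-off {u} {v} u≢v with u Fin.≟ v
  ... | yes u≡v = ⊥-elim (u≢v u≡v)
  ... | no _    = refl

  offDiagonal-sym : (∀ u v → c u v ≡ c v u) → ∀ u v → offDiagonal c u v ≡ offDiagonal c v u
  offDiagonal-sym c-sym u v with u Fin.≟ v | v Fin.≟ u
  ... | yes _   | yes _   = refl
  ... | no _    | no _    = c-sym u v
  ... | yes u≡v | no v≢u  = ⊥-elim (v≢u (sym u≡v))
  ... | no u≢v  | yes v≡u = ⊥-elim (u≢v (sym v≡u))

  linCost-double : ∀ (x : Fin n → Fin n → ℚ) → (∀ u v → c u v ≡ c v u) → (∀ u v → x u v ≡ x v u) →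
    linCost c x + linCost c x ≡ Σ[ (λ u → Σ[ (λ v → x u v * offDiagonal c u v) ]) ]
  linCost-double x c-sym x-sym = trans (cong (linCost c x +_) (Σ-comm G))
    (trans (sym (Σ₂-distrib-+ G (λ u v → G v u))) (Σ-cong (λ u → Σ-cong (pair u))))
    where
    G : Fin n → Fin n → ℚ
    G u v = [ ⌊ toℕ u ℕ.<? toℕ v ⌋ ]ᵇ * (c u v * x u v)
    one-zero : ∀ a b → 1ℚ * a + 0ℚ * b ≡ a
    one-zero = solve-∀ ℚ-ring
    zero-one : ∀ a b → 0ℚ * a + 1ℚ * b ≡ b
    zero-one = solve-∀ ℚ-ring
    distinct : ∀ {u v} → toℕ u ℕ.< toℕ v → ¬ u ≡ v
    distinct u<v u≡v = ℕP.<-irrefl (cong toℕ u≡v) u<v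
    off-product : ∀ {u v} → ¬ u ≡ v → c u v * x u v ≡ x u v * offDiagonal c u v
    off-product {u} {v} u≢v = trans (QP.*-comm (c u v) (x u v)) (cong (x u v *_) (sym (offDiagonal-off u≢v)))
    pair : ∀ u v → G u v + G v u ≡ x u v * offDiagonal c u v
    pair u v with toℕ u ℕ.<? toℕ v | toℕ v ℕ.<? toℕ u
    ... | yes u<v | yes v<u = ⊥-elim (ℕP.<-asym u<v v<u)
    ... | yes u<v | no _    = trans (one-zero (c u v * x u v) (c v u * x v u)) (off-product (distinct u<v))
    ... | no _    | yes v<u = trans (zero-one (c u v * x u v) (c v u * x v u))
                                    (trans (cong₂ _*_ (c-sym v u) (x-sym v u)) (off-product (distinct v<u ∘ sym)))
    ... | no u≮v  | no v≮u  with FinP.toℕ-injective (ℕP.≤-antisym (ℕP.≮⇒≥ v≮u) (ℕP.≮⇒≥ u≮v))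
    ...   | refl = trans (cong₂ _+_ (QP.*-zeroˡ (c u u * x u u)) (QP.*-zeroˡ (c u u * x u u)))
                         (sym (trans (cong (x u u *_) (offDiagonal-diag u)) (QP.*-zeroʳ (x u u))))

record IsPseudometric {A : Set} (g : A → A → ℚ) : Set where
  field
    symmetric : ∀ u v → g u v ≡ g v u
    diagonal  : ∀ u → g u u ≡ 0ℚ
    triangle  : ∀ u v w → g u w ≤ g u v + g v w

offDiagonal-isPseudometric : ∀ {n} {c : Fin n → Fin n → ℚ} → IsMetricCost n c → IsPseudometric (offDiagonal c)
offDiagonal-isPseudometric {c = c} metric = record
  { symmetric = offDiagonal-sym c symmetric
  ; diagonal  = offDiagonal-diag c
  ; triangle  = triangle′
  }
  where
  open IsMetricCost metric
  nonNeg : ∀ u v → 0ℚ ≤ offDiagonal c u v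
  nonNeg u v with u Fin.≟ v
  ... | yes _   = QP.≤-refl
  ... | no u≢v  = nonnegative u v u≢v
  triangle′ : ∀ u v w → offDiagonal c u w ≤ offDiagonal c u v + offDiagonal c v w
  triangle′ u v w with u Fin.≟ w
  ... | yes refl = QP.+-mono-≤ (nonNeg u v) (nonNeg v u)
  ... | no u≢w   = via (u Fin.≟ v) (v Fin.≟ w)
    where
    via : Dec (u ≡ v) → Dec (v ≡ w) → c u w ≤ offDiagonal c u v + offDiagonal c v w
    via (yes refl) _ = QP.≤-reflexive (sym (trans (cong₂ _+_ (offDiagonal-diag c u) (offDiagonal-off c u≢w))
                                                  (QP.+-identityˡ (c u w))))
    via (no u≢v) (yes refl) = QP.≤-reflexive (sym (trans (cong₂ _+_ (offDiagonal-off c u≢v) (offDiagonal-diag c v))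
                                                         (QP.+-identityʳ (c u v))))
    via (no u≢v) (no v≢w) = QP.≤-trans (triangle u v w u≢v v≢w u≢w)
      (QP.≤-reflexive (sym (cong₂ _+_ (offDiagonal-off c u≢v) (offDiagonal-off c v≢w))))

cong₃ : ∀ {A B C D : Set} (f : A → B → C → D) {a a′ b b′ c c′} →
        a ≡ a′ → b ≡ b′ → c ≡ c′ → f a b c ≡ f a′ b′ c′
cong₃ f refl refl refl = refl

reverseWalk : ∀ {A : Set} → A → List A → A × List A
reverseWalk x []       = x , []
reverseWalk x (y ∷ ys) = proj₁ (reverseWalk y ys) , proj₂ (reverseWalk y ys) ++ [ x ]

proj₁-reverseWalk : ∀ {A : Set} (x : A) xs → proj₁ (reverseWalk x xs) ≡ walkEnd x xs
proj₁-reverseWalk x []       = refl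
proj₁-reverseWalk x (y ∷ ys) = proj₁-reverseWalk y ys

walkEnd-reverseWalk : ∀ {A : Set} (x : A) xs → walkEnd (proj₁ (reverseWalk x xs)) (proj₂ (reverseWalk x xs)) ≡ x
walkEnd-reverseWalk x []       = refl
walkEnd-reverseWalk x (y ∷ ys) = walkEnd-++ (proj₁ (reverseWalk y ys)) (proj₂ (reverseWalk y ys)) x []

↭-reverseWalk : ∀ {A : Set} (x : A) xs → proj₁ (reverseWalk x xs) ∷ proj₂ (reverseWalk x xs) ↭ x ∷ xs
↭-reverseWalk x []       = ↭-refl
↭-reverseWalk x (y ∷ ys) =
  ↭-trans (↭P.++-comm (proj₁ (reverseWalk y ys) ∷ proj₂ (reverseWalk y ys)) [ x ]) (prep x (↭-reverseWalk y ys))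

module Tours {A : Set} {g : A → A → ℚ} (pseudometric : IsPseudometric g) where

  open IsPseudometric pseudometric
  open Walks g

  walkCost-reverseWalk : ∀ x xs → walkCost (proj₁ (reverseWalk x xs)) (proj₂ (reverseWalk x xs)) ≡ walkCost x xs
  walkCost-reverseWalk x []       = refl
  walkCost-reverseWalk x (y ∷ ys) = begin-equality
    walkCost y′ (ys′ ++ [ x ])                    ≡⟨ walkCost-++ y′ ys′ x [] ⟩
    walkCost y′ ys′ + g (walkEnd y′ ys′) x + 0ℚ    ≡⟨ cong₂ (λ s t → s + t + 0ℚ) (walkCost-reverseWalk y ys)
                                                         (trans (cong (λ e → g e x) (walkEnd-reverseWalk y ys)) (symmetric y x)) ⟩
    walkCost y ys + g x y + 0ℚ                    ≡⟨ flip (walkCost y ys) (g x y) ⟩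
    g x y + walkCost y ys                         ∎
    where
    open QP.≤-Reasoning
    y′ = proj₁ (reverseWalk y ys)
    ys′ = proj₂ (reverseWalk y ys)
    flip : ∀ a b → a + b + 0ℚ ≡ b + a
    flip = solve-∀ ℚ-ring

  shortcut : ∀ x xs → g x (walkEnd x xs) ≤ walkCost x xs
  shortcut x []       = QP.≤-reflexive (diagonal x)
  shortcut x (y ∷ ys) = QP.≤-trans (triangle x y (walkEnd y ys)) (QP.+-monoʳ-≤ (g x y) (shortcut y ys))

  shortcut-back : ∀ x xs → g (walkEnd x xs) x ≤ walkCost x xs
  shortcut-back x xs = QP.≤-trans (QP.≤-reflexive (symmetric (walkEnd x xs) x)) (shortcut x xs)

  closedWalkCost-++₃ : ∀ a as b bs c cs → closedWalkCost a (as ++ b ∷ bs ++ c ∷ cs) ≡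
    walkCost a as + g (walkEnd a as) b + walkCost b bs + g (walkEnd b bs) c + walkCost c cs + g (walkEnd c cs) a
  closedWalkCost-++₃ a as b bs c cs = begin-equality
    walkCost a (as ++ b ∷ bs ++ c ∷ cs) + g (walkEnd a (as ++ b ∷ bs ++ c ∷ cs)) a
      ≡⟨ cong₂ _+_ (trans (walkCost-++ a as b (bs ++ c ∷ cs)) (cong (walkCost a as + g (walkEnd a as) b +_) (walkCost-++ b bs c cs)))
                   (cong (λ e → g e a) (trans (walkEnd-++ a as b (bs ++ c ∷ cs)) (walkEnd-++ b bs c cs))) ⟩
    walkCost a as + g (walkEnd a as) b + (walkCost b bs + g (walkEnd b bs) c + walkCost c cs) + g (walkEnd c cs) a
      ≡⟨ assoc (walkCost a as + g (walkEnd a as) b) (walkCost b bs) (g (walkEnd b bs) c) (walkCost c cs) (g (walkEnd c cs) a) ⟩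
    walkCost a as + g (walkEnd a as) b + walkCost b bs + g (walkEnd b bs) c + walkCost c cs + g (walkEnd c cs) a ∎
    where
    open QP.≤-Reasoning
    assoc : ∀ p q r s t → p + (q + r + s) + t ≡ p + q + r + s + t
    assoc = solve-∀ ℚ-ring

  record Tour (L : List A) (bound : ℚ) : Set where
    field
      start  : A
      rest   : List A
      covers : start ∷ rest ↭ L
      cost≤  : closedWalkCost start rest ≤ bound

  doubling₁ : ∀ u us w ws z zs → Tour ((u ∷ us) ++ (w ∷ ws) ++ (z ∷ zs))
    (walkCost u us + walkCost u us + walkCost w ws + walkCost z zs +
     g (walkEnd u us) (walkEnd w ws) + g w z + g (walkEnd z zs) (walkEnd u us))
  doubling₁ u us w ws z zs = record
    { start  = u
    ; rest   = us ++ w′ ∷ ws′ ++ z ∷ zs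
    ; covers = prep u (↭P.++⁺ˡ us (↭P.++⁺ʳ (z ∷ zs) (↭-reverseWalk w ws)))
    ; cost≤  = begin
      closedWalkCost u (us ++ w′ ∷ ws′ ++ z ∷ zs)
        ≡⟨ closedWalkCost-++₃ u us w′ ws′ z zs ⟩
      U + g uₗ w′ + walkCost w′ ws′ + g (walkEnd w′ ws′) z + Z + g zₗ u
        ≡⟨ cong₃ (λ a b c → U + g uₗ a + b + g c z + Z + g zₗ u)
             (proj₁-reverseWalk w ws) (walkCost-reverseWalk w ws) (walkEnd-reverseWalk w ws) ⟩
      U + g uₗ wₗ + W + g w z + Z + g zₗ u
        ≤⟨ QP.+-monoʳ-≤ (U + g uₗ wₗ + W + g w z + Z)
             (QP.≤-trans (triangle zₗ uₗ u) (QP.+-monoʳ-≤ (g zₗ uₗ) (shortcut-back u us))) ⟩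
      U + g uₗ wₗ + W + g w z + Z + (g zₗ uₗ + U)
        ≡⟨ rearrange U W Z (g uₗ wₗ) (g w z) (g zₗ uₗ) ⟩
      U + U + W + Z + g uₗ wₗ + g w z + g zₗ uₗ ∎
    }
    where
    open QP.≤-Reasoning
    w′ = proj₁ (reverseWalk w ws)
    ws′ = proj₂ (reverseWalk w ws)
    U = walkCost u us
    W = walkCost w ws
    Z = walkCost z zs
    uₗ = walkEnd u us
    wₗ = walkEnd w ws
    zₗ = walkEnd z zs
    rearrange : ∀ U W Z a b c → U + a + W + b + Z + (c + U) ≡ U + U + W + Z + a + b + c
    rearrange = solve-∀ ℚ-ring

  doubling₂ : ∀ u us w ws z zs → Tour ((u ∷ us) ++ (w ∷ ws) ++ (z ∷ zs))
    (walkCost u us + walkCost u us + walkCost w ws + walkCost z zs +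
     g u w + g (walkEnd w ws) (walkEnd z zs) + g z u)
  doubling₂ u us w ws z zs = record
    { start  = u′
    ; rest   = us′ ++ w ∷ ws ++ z′ ∷ zs′
    ; covers = ↭-trans (↭P.++⁺ʳ ((w ∷ ws) ++ z′ ∷ zs′) (↭-reverseWalk u us))
                       (↭P.++⁺ˡ (u ∷ us) (↭P.++⁺ˡ (w ∷ ws) (↭-reverseWalk z zs)))
    ; cost≤  = begin
      closedWalkCost u′ (us′ ++ w ∷ ws ++ z′ ∷ zs′)
        ≡⟨ closedWalkCost-++₃ u′ us′ w ws z′ zs′ ⟩
      walkCost u′ us′ + g (walkEnd u′ us′) w + W + g wₗ z′ + walkCost z′ zs′ + g (walkEnd z′ zs′) u′
        ≡⟨ cong₃ (λ a b c → a + g b w + W + g wₗ c + walkCost z′ zs′ + g (walkEnd z′ zs′) u′)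
             (walkCost-reverseWalk u us) (walkEnd-reverseWalk u us) (proj₁-reverseWalk z zs) ⟩
      U + g u w + W + g wₗ zₗ + walkCost z′ zs′ + g (walkEnd z′ zs′) u′
        ≡⟨ cong₃ (λ a b c → U + g u w + W + g wₗ zₗ + a + g b c)
             (walkCost-reverseWalk z zs) (walkEnd-reverseWalk z zs) (proj₁-reverseWalk u us) ⟩
      U + g u w + W + g wₗ zₗ + Z + g z uₗ
        ≤⟨ QP.+-monoʳ-≤ (U + g u w + W + g wₗ zₗ + Z)
             (QP.≤-trans (triangle z u uₗ) (QP.+-monoʳ-≤ (g z u) (shortcut u us))) ⟩
      U + g u w + W + g wₗ zₗ + Z + (g z u + U)
        ≡⟨ rearrange U W Z (g u w) (g wₗ zₗ) (g z u) ⟩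
      U + U + W + Z + g u w + g wₗ zₗ + g z u ∎
    }
    where
    open QP.≤-Reasoning
    u′ = proj₁ (reverseWalk u us)
    us′ = proj₂ (reverseWalk u us)
    z′ = proj₁ (reverseWalk z zs)
    zs′ = proj₂ (reverseWalk z zs)
    U = walkCost u us
    W = walkCost w ws
    Z = walkCost z zs
    uₗ = walkEnd u us
    wₗ = walkEnd w ws
    zₗ = walkEnd z zs
    rearrange : ∀ U W Z a b c → U + a + W + b + Z + (c + U) ≡ U + U + W + Z + a + b + c
    rearrange = solve-∀ ℚ-ring

  splitting : ∀ u ps v vs w ws z zs → Tour ((u ∷ ps ++ v ∷ vs) ++ (w ∷ ws) ++ (z ∷ zs))
    (walkCost u ps + walkCost u ps + walkCost v vs + walkCost v vs + walkCost w ws + walkCost z zs +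
     g u w + g (walkEnd v vs) (walkEnd w ws) + g (walkEnd z zs) (walkEnd v vs) + g z u)
  splitting u ps v vs w ws z zs = record
    { start  = u
    ; rest   = ps ++ w ∷ ws ++ v ∷ vs ++ z′ ∷ zs′
    ; covers = prep u (↭-trans (↭P.++⁺ˡ ps (↭-trans (↭P.shifts (w ∷ ws) (v ∷ vs))
                                  (↭P.++⁺ˡ (v ∷ vs) (↭P.++⁺ˡ (w ∷ ws) (↭-reverseWalk z zs)))))
                               (↭-reflexive (sym (ListP.++-assoc ps (v ∷ vs) ((w ∷ ws) ++ z ∷ zs)))))
    ; cost≤  = begin
      closedWalkCost u (ps ++ w ∷ ws ++ v ∷ vs ++ z′ ∷ zs′)
        ≡⟨ closedWalkCost-++₃ u ps w ws v (vs ++ z′ ∷ zs′) ⟩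
      P₁ + g p₁ w + W + g wₗ v + walkCost v (vs ++ z′ ∷ zs′) + g (walkEnd v (vs ++ z′ ∷ zs′)) u
        ≡⟨ cong₂ (λ s t → P₁ + g p₁ w + W + g wₗ v + s + g t u)
             (trans (walkCost-++ v vs z′ zs′) (cong₂ (λ s t → P₂ + g vₗ s + t) (proj₁-reverseWalk z zs) (walkCost-reverseWalk z zs)))
             (trans (walkEnd-++ v vs z′ zs′) (walkEnd-reverseWalk z zs)) ⟩
      P₁ + g p₁ w + W + g wₗ v + (P₂ + g vₗ zₗ + Z) + g z u
        ≤⟨ QP.+-monoˡ-≤ (g z u) (QP.+-mono-≤ (QP.+-mono-≤ (QP.+-monoˡ-≤ W (QP.+-monoʳ-≤ P₁ leave-u)) return-v)
                                              (QP.≤-reflexive (cong (λ s → P₂ + s + Z) (symmetric vₗ zₗ)))) ⟩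
      P₁ + (P₁ + g u w) + W + (g vₗ wₗ + P₂) + (P₂ + g zₗ vₗ + Z) + g z u
        ≡⟨ rearrange P₁ P₂ W Z (g u w) (g vₗ wₗ) (g zₗ vₗ) (g z u) ⟩
      P₁ + P₁ + P₂ + P₂ + W + Z + g u w + g vₗ wₗ + g zₗ vₗ + g z u ∎
    }
    where
    open QP.≤-Reasoning
    z′ = proj₁ (reverseWalk z zs)
    zs′ = proj₂ (reverseWalk z zs)
    P₁ = walkCost u ps
    P₂ = walkCost v vs
    W = walkCost w ws
    Z = walkCost z zs
    p₁ = walkEnd u ps
    vₗ = walkEnd v vs
    wₗ = walkEnd w ws
    zₗ = walkEnd z zs
    leave-u : g p₁ w ≤ P₁ + g u w
    leave-u = QP.≤-trans (triangle p₁ u w) (QP.+-monoˡ-≤ (g u w) (shortcut-back u ps))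
    return-v : g wₗ v ≤ g vₗ wₗ + P₂
    return-v = QP.≤-trans (triangle wₗ vₗ v)
      (QP.+-mono-≤ (QP.≤-reflexive (symmetric wₗ vₗ)) (shortcut-back v vs))
    rearrange : ∀ P₁ P₂ W Z a b c d →
      P₁ + (P₁ + a) + W + (b + P₂) + (P₂ + c + Z) + d ≡ P₁ + P₁ + P₂ + P₂ + W + Z + a + b + c + d
    rearrange = solve-∀ ℚ-ring

record Enumeration (N : ℕ) (L : List (Fin N)) : Set where
  field
    unique   : Unique L
    complete : ∀ v → v ∈ L
    length≡  : length L ≡ N

Enumeration-resp-↭ : ∀ {N} {L L′ : List (Fin N)} → L ↭ L′ → Enumeration N L → Enumeration N L′
Enumeration-resp-↭ {N} L↭L′ enum = record
  { unique   = ↭ₛP.Unique-resp-↭ (setoid (Fin N)) (↭⇒↭ₛ L↭L′) unique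
  ; complete = λ v → ↭P.∈-resp-↭ L↭L′ (complete v)
  ; length≡  = trans (sym (↭P.↭-length L↭L′)) length≡
  }
  where open Enumeration enum

tabulate-enumeration : ∀ {m N} (π : Permutation m N) → Enumeration N (tabulate (π ⟨$⟩ʳ_))
tabulate-enumeration π = record
  { unique   = UniqueP.tabulate⁺ (λ e → trans (sym (Perm.inverseˡ π)) (trans (cong (π ⟨$⟩ˡ_) e) (Perm.inverseˡ π)))
  ; complete = λ v → subst (_∈ tabulate (π ⟨$⟩ʳ_)) (Perm.inverseʳ π) (∈-tabulate⁺ (π ⟨$⟩ˡ v))
  ; length≡  = trans (ListP.length-tabulate (π ⟨$⟩ʳ_)) (Perm.↔⇒≡ π)
  }

next-inject₁ : ∀ {m} (t : Fin m) → next {suc m} (inject₁ t) ≡ suc t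
next-inject₁ {m} t with toℕ (inject₁ t) ℕ.<? m
... | yes t<m = FinP.toℕ-injective (trans (FinP.toℕ-fromℕ< (ℕ.s≤s t<m)) (cong suc (FinP.toℕ-inject₁ t)))
... | no  t≮m = ⊥-elim (t≮m (subst (ℕ._< m) (sym (FinP.toℕ-inject₁ t)) (FinP.toℕ<n t)))

next-fromℕ : ∀ m → next {suc m} (fromℕ m) ≡ zero
next-fromℕ m with toℕ (fromℕ m) ℕ.<? m
... | yes m<m = ⊥-elim (ℕP.<-irrefl (FinP.toℕ-fromℕ m) m<m)
... | no  _   = refl

next-≢ : ∀ {m} (t : Fin (suc (suc m))) → ¬ next t ≡ t
next-≢ {m} t with toℕ t ℕ.<? suc m
... | yes t<m = λ e → ℕP.1+n≢n (trans (sym (FinP.toℕ-fromℕ< (ℕ.s≤s t<m))) (cong toℕ e))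
... | no  t≮m = λ e → t≮m (subst (λ s → toℕ s ℕ.< suc m) e (ℕ.s≤s ℕ.z≤n))

next-cast : ∀ {m n} (e : m ≡ n) (t : Fin m) → next (Fin.cast e t) ≡ Fin.cast e (next t)
next-cast refl t = trans (cong next (FinP.cast-is-id refl t)) (sym (FinP.cast-is-id refl (next t)))

lookup-injective : ∀ {A : Set} {xs : List A} → Unique xs → ∀ {a b} → lookup xs a ≡ lookup xs b → a ≡ b
lookup-injective (_ ∷ _)      {zero}  {zero}  _ = refl
lookup-injective (x∉ ∷ _)     {zero}  {suc b} e = ⊥-elim (All.lookup x∉ (∈-lookup b) e)
lookup-injective (x∉ ∷ _)     {suc a} {zero}  e = ⊥-elim (All.lookup x∉ (∈-lookup a) (sym e))
lookup-injective (_ ∷ unique) {suc a} {suc b} e = cong suc (lookup-injective unique e)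

lookup-fromℕ : ∀ {A : Set} (x : A) xs → lookup (x ∷ xs) (fromℕ (length xs)) ≡ walkEnd x xs
lookup-fromℕ x []       = refl
lookup-fromℕ x (y ∷ ys) = lookup-fromℕ y ys

module _ {A : Set} (g : A → A → ℚ) where

  open Walks g

  Σ-walk : ∀ x xs → Σ[ (λ t → g (lookup (x ∷ xs) (inject₁ t)) (lookup xs t)) ] ≡ walkCost x xs
  Σ-walk x []       = refl
  Σ-walk x (y ∷ ys) = cong (g x y +_) (Σ-walk y ys)

  Σ-cycle : ∀ x xs → Σ[ (λ t → g (lookup (x ∷ xs) t) (lookup (x ∷ xs) (next t))) ] ≡ closedWalkCost x xs
  Σ-cycle x xs = trans (Σ-init-last (λ t → g (ℓ t) (ℓ (next t))))
    (cong₂ _+_ (trans (Σ-cong (λ t → cong (λ s → g (ℓ (inject₁ t)) (ℓ s)) (next-inject₁ t))) (Σ-walk x xs))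
               (cong₂ g (lookup-fromℕ x xs) (cong ℓ (next-fromℕ (length xs)))))
    where
    ℓ = lookup (x ∷ xs)

hamiltonianCycle : ∀ {N} (c : Fin N → Fin N → ℚ) x xs → Enumeration N (x ∷ xs) → 2 ℕ.≤ N →
  Σ (HamiltonianCycle N) λ H → tourCost c H ≡ Walks.closedWalkCost (offDiagonal c) x xs
hamiltonianCycle c x [] enum 2≤N with () ← ℕP.<⇒≱ 2≤N (ℕP.≤-reflexive (sym (Enumeration.length≡ enum)))
hamiltonianCycle {N} c x (y ∷ ys) enum _ =
  record { order = mk⤖ (σ-injective , σ-surjective) } ,
  (begin
    Σ[ (λ t → c (σ t) (σ (next t))) ]
      ≡⟨ Σ-cast length≡ (λ t → c (σ t) (σ (next t))) ⟩
    Σ[ (λ s → c (σ (Fin.cast length≡ s)) (σ (next (Fin.cast length≡ s)))) ]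
      ≡⟨ Σ-cong (λ s → cong₂ c (cong ℓ (cast-back s))
                               (trans (cong σ (next-cast length≡ s)) (cong ℓ (cast-back (next s))))) ⟩
    Σ[ (λ s → c (ℓ s) (ℓ (next s))) ]
      ≡⟨ Σ-cong (λ s → sym (offDiagonal-off c (λ e → next-≢ s (sym (lookup-injective unique e))))) ⟩
    Σ[ (λ s → offDiagonal c (ℓ s) (ℓ (next s))) ]
      ≡⟨ Σ-cycle (offDiagonal c) x (y ∷ ys) ⟩
    Walks.closedWalkCost (offDiagonal c) x (y ∷ ys) ∎)
  where
  open ≡-Reasoning
  open Enumeration enum
  ℓ = lookup (x ∷ y ∷ ys)
  σ : Fin N → Fin N
  σ t = ℓ (Fin.cast (sym length≡) t)
  cast-back : ∀ s → Fin.cast (sym length≡) (Fin.cast length≡ s) ≡ s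
  cast-back = FinP.cast-involutive (sym length≡) length≡
  σ-injective : ∀ {a b} → σ a ≡ σ b → a ≡ b
  σ-injective {a} {b} e = trans (sym (FinP.cast-involutive length≡ (sym length≡) a))
    (trans (cong (Fin.cast length≡) (lookup-injective unique e)) (FinP.cast-involutive length≡ (sym length≡) b))
  σ-surjective : ∀ v → ∃ λ t → ∀ {s} → s ≡ t → σ s ≡ v
  σ-surjective v = Fin.cast length≡ (Any.index (complete v)) ,
    λ { refl → trans (cong ℓ (cast-back _)) (sym (AnyP.lookup-index (complete v))) }

double-injective : ∀ {a b} → a + a ≡ b + b → a ≡ b
double-injective {a} {b} a+a≡b+b = trans (sym (half-double a)) (trans (cong (½ *_) a+a≡b+b) (half-double b))
  where
  half-double : ∀ a → ½ * (a + a) ≡ a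
  half-double = solve-∀ ℚ-ring

module Placement {i j k N : ℕ} (φ : Fin N ⤖ V i j k) where

  open Vertices i j k

  ψ : V i j k → Fin N
  ψ = Inverse.from (⤖⇒↔ φ)

  Σ-reindex : ∀ f → Σ[ f ] ≡ ΣV (f ∘ ψ)
  Σ-reindex f = trans (Σ-permute f (↔-trans Fin↔V (↔-sym (⤖⇒↔ φ)))) (Σ-toV (f ∘ ψ))

  enumeration : Enumeration N (tabulate (ψ ∘ X) ++ tabulate (ψ ∘ Y) ++ tabulate (ψ ∘ Z))
  enumeration = subst (Enumeration N) (tabulate-toV ψ) (tabulate-enumeration (↔-trans Fin↔V (↔-sym (⤖⇒↔ φ))))

  2≤N : 2 ℕ.≤ N
  2≤N = subst (2 ℕ.≤_) (Enumeration.length≡ enumeration) (ℕ.s≤s (ℕ.s≤s ℕ.z≤n))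

  linCost≡lpValue : ∀ c x → (∀ u v → c u v ≡ c v u) → (∀ u v → x u v ≡ x v u) →
    (∀ u v → ¬ u ≡ v → x u v ≡ weight i j k (Bijection.to φ u) (Bijection.to φ v)) →
    linCost c x ≡ Walks.lpValue (offDiagonal c) (ψ ∘ X) (ψ ∘ Y) (ψ ∘ Z)
  linCost≡lpValue c x c-sym x-sym iso = double-injective (begin
    linCost c x + linCost c x
      ≡⟨ linCost-double c x c-sym x-sym ⟩
    Σ[ (λ u → Σ[ (λ v → x u v * d u v) ]) ]
      ≡⟨ trans (Σ-cong (λ u → Σ-reindex (λ v → x u v * d u v))) (Σ-reindex (λ u → ΣV (λ q → x u (ψ q) * d u (ψ q)))) ⟩
    ΣV (λ p → ΣV (λ q → x (ψ p) (ψ q) * d (ψ p) (ψ q)))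
      ≡⟨ ΣV-cong (λ p → ΣV-cong (λ q → x-on-placement p q)) ⟩
    ΣV (λ p → ΣV (λ q → weight i j k p q * d (ψ p) (ψ q)))
      ≡⟨ ΣV-weight d (offDiagonal-sym c c-sym) ψ ⟩
    Walks.lpValue d (ψ ∘ X) (ψ ∘ Y) (ψ ∘ Z) + Walks.lpValue d (ψ ∘ X) (ψ ∘ Y) (ψ ∘ Z) ∎)
    where
    open ≡-Reasoning
    d = offDiagonal c
    x-on-placement : ∀ p q → x (ψ p) (ψ q) * d (ψ p) (ψ q) ≡ weight i j k p q * d (ψ p) (ψ q)
    x-on-placement p q with ψ p Fin.≟ ψ q
    ... | yes _    = trans (QP.*-zeroʳ (x (ψ p) (ψ q))) (sym (QP.*-zeroʳ (weight i j k p q)))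
    ... | no ψp≢ψq = cong (_* c (ψ p) (ψ q)) (trans (iso (ψ p) (ψ q) ψp≢ψq)
                       (cong₂ (weight i j k) (Inverse.strictlyInverseˡ (⤖⇒↔ φ) p) (Inverse.strictlyInverseˡ (⤖⇒↔ φ) q)))

Enumeration-rotate : ∀ {N} (A B C : List (Fin N)) → Enumeration N (A ++ B ++ C) → Enumeration N (B ++ C ++ A)
Enumeration-rotate A B C = Enumeration-resp-↭ (↭-trans (↭P.++-comm A (B ++ C)) (↭-reflexive (ListP.++-assoc B C A)))

rotation-bound : ∀ {T α U e} D₁ D₂ B S L → 0ℚ ≤ α → α * U ≤ e → T ≤ D₁ → T ≤ D₂ → T ≤ B →
  D₁ + D₂ ≡ (L + L) + (U + U) → B + (e + e) ≡ S → T + α * (T + T) ≤ S + α * (L + L)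
rotation-bound {T} {α} {U} {e} D₁ D₂ B S L 0≤α αU≤e T≤D₁ T≤D₂ T≤B D₁+D₂≡ B+2e≡S = begin
  T + α * (T + T)                    ≤⟨ QP.+-mono-≤ T≤B (QP.*-monoˡ-≤-nonNeg α {{nonNegative 0≤α}} (QP.+-mono-≤ T≤D₁ T≤D₂)) ⟩
  B + α * (D₁ + D₂)                  ≡⟨ cong (λ t → B + α * t) D₁+D₂≡ ⟩
  B + α * ((L + L) + (U + U))        ≡⟨ distrib B α L U ⟩
  B + (α * U + α * U) + α * (L + L)  ≤⟨ QP.+-monoˡ-≤ (α * (L + L)) (QP.+-monoʳ-≤ B (QP.+-mono-≤ αU≤e αU≤e)) ⟩
  B + (e + e) + α * (L + L)          ≡⟨ cong (_+ α * (L + L)) B+2e≡S ⟩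
  S + α * (L + L)                    ∎
  where
  open QP.≤-Reasoning
  distrib : ∀ B α L U → B + α * ((L + L) + (U + U)) ≡ B + (α * U + α * U) + α * (L + L)
  distrib = solve-∀ ℚ-ring

averaging : ∀ i j k {T L S₁ S₂ S₃} →
  T + inv1+ i * (T + T) ≤ S₁ + inv1+ i * (L + L) →
  T + inv1+ j * (T + T) ≤ S₂ + inv1+ j * (L + L) →
  T + inv1+ k * (T + T) ≤ S₃ + inv1+ k * (L + L) →
  S₁ + S₂ + S₃ ≡ (L + L) + (L + L) → T ≤ bound i j k * L
averaging i j k {T} {L} {S₁} {S₂} {S₃} h₁ h₂ h₃ S-sum = begin
  T                          ≡⟨ sym (trans (cong (_* T) δ*den≡1) (QP.*-identityˡ T)) ⟩
  δ * den * T                ≡⟨ QP.*-assoc δ den T ⟩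
  δ * (den * T)              ≤⟨ QP.*-monoˡ-≤-nonNeg δ {{QP.pos⇒nonNeg δ {{QP.1/pos⇒pos den {{denom-pos i j k}}}}}} den*T≤ ⟩
  δ * ((den + 1ℚ) * L)       ≡⟨ expand δ den L ⟩
  (δ * den + δ) * L          ≡⟨ cong (λ t → (t + δ) * L) δ*den≡1 ⟩
  (1ℚ + δ) * L               ∎
  where
  open QP.≤-Reasoning
  den = denom i j k
  δ = (1/ den) {{QP.pos⇒nonZero den {{denom-pos i j k}}}}
  δ*den≡1 : δ * den ≡ 1ℚ
  δ*den≡1 = QP.*-inverseˡ den {{QP.pos⇒nonZero den {{denom-pos i j k}}}}
  expand : ∀ δ d L → δ * ((d + 1ℚ) * L) ≡ (δ * d + δ) * L
  expand = solve-∀ ℚ-ring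
  spread : ∀ α β γ T → ((ℤ.+ 3 / 1) + (ℤ.+ 2 / 1) * (α + β + γ)) * T ≡
                        (T + α * (T + T)) + (T + β * (T + T)) + (T + γ * (T + T))
  spread = solve-∀ ℚ-ring
  gather : ∀ α β γ S₁ S₂ S₃ L → (S₁ + α * (L + L)) + (S₂ + β * (L + L)) + (S₃ + γ * (L + L)) ≡
                                 (S₁ + S₂ + S₃) + (α + β + γ) * (L + L)
  gather = solve-∀ ℚ-ring
  collect : ∀ α β γ L → (L + L) + (L + L) + (α + β + γ) * (L + L) ≡ ((ℤ.+ 3 / 1) + (ℤ.+ 2 / 1) * (α + β + γ) + 1ℚ) * L
  collect = solve-∀ ℚ-ring
  den*T≤ : den * T ≤ (den + 1ℚ) * L
  den*T≤ = begin
    den * T                                                     ≡⟨ spread (inv1+ i) (inv1+ j) (inv1+ k) T ⟩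
    (T + inv1+ i * (T + T)) + (T + inv1+ j * (T + T)) + (T + inv1+ k * (T + T))
                                                                ≤⟨ QP.+-mono-≤ (QP.+-mono-≤ h₁ h₂) h₃ ⟩
    (S₁ + inv1+ i * (L + L)) + (S₂ + inv1+ j * (L + L)) + (S₃ + inv1+ k * (L + L))
                                                                ≡⟨ gather (inv1+ i) (inv1+ j) (inv1+ k) S₁ S₂ S₃ L ⟩
    (S₁ + S₂ + S₃) + (inv1+ i + inv1+ j + inv1+ k) * (L + L)   ≡⟨ cong (_+ (inv1+ i + inv1+ j + inv1+ k) * (L + L)) S-sum ⟩
    (L + L) + (L + L) + (inv1+ i + inv1+ j + inv1+ k) * (L + L) ≡⟨ collect (inv1+ i) (inv1+ j) (inv1+ k) L ⟩
    (den + 1ℚ) * L                                              ∎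

module TSPInstance {N} {c : Fin N → Fin N → ℚ} (metric : IsMetricCost N c) (2≤N : 2 ℕ.≤ N) where

  open Walks (offDiagonal c)
  open Tours (offDiagonal-isPseudometric metric)

  realise : ∀ {L b} → Enumeration N L → Tour L b → Σ (HamiltonianCycle N) λ H → tourCost c H ≤ b
  realise enum T = proj₁ H , QP.≤-trans (QP.≤-reflexive (proj₂ H)) cost≤
    where
    open Tour T
    H = hamiltonianCycle c start rest (Enumeration-resp-↭ (↭-sym covers) enum) 2≤N

  identityCycle : HamiltonianCycle N
  identityCycle = record { order = ⤖-id _ }

  record Rotation (α S L : ℚ) : Set where
    field
      tours : List (HamiltonianCycle N)
      weighted : ∀ T → All (λ H → T ≤ tourCost c H) tours → T + α * (T + T) ≤ S + α * (L + L)

  rotation : ∀ {a b e} (P : Fin (suc (suc a)) → Fin N) (Q : Fin (suc b) → Fin N) (R : Fin (suc e) → Fin N) →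
    Enumeration N (tabulate P ++ tabulate Q ++ tabulate R) → Rotation (inv1+ a) (splitTourBound P Q R) (lpValue P Q R)
  rotation {a} P Q R enum = record
    { tours = proj₁ t₁ ∷ proj₁ t₂ ∷ proj₁ t₃ ∷ []
    ; weighted = λ { T (T≤t₁ ∷ T≤t₂ ∷ T≤t₃ ∷ []) →
        rotation-bound _ _ _ (splitTourBound P Q R) (lpValue P Q R) (inv1+-nonNeg a) heavy-bound
          (QP.≤-trans T≤t₁ (proj₂ t₁)) (QP.≤-trans T≤t₂ (proj₂ t₂)) (QP.≤-trans T≤t₃ (proj₂ t₃))
          (doubling-sum U W Z (g u w) (g w z) (g z u) (g uₗ wₗ) (g wₗ zₗ) (g zₗ uₗ))
          (trans (saving (walkCost u before) e′ (walkCost v after) W Z (g u w) (g vₗ wₗ) (g zₗ vₗ) (g z u))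
                 (sym (cong₃ (λ s t r → s + s + W + Z + g u w + g t wₗ + g zₗ r + g z u) U≡ uₗ≡ uₗ≡))) }
    }
    where
    g = offDiagonal c
    u = P zero
    us = tabulate (P ∘ suc)
    w = Q zero
    ws = tabulate (Q ∘ suc)
    z = R zero
    zs = tabulate (R ∘ suc)
    U = walkCost u us
    W = walkCost w ws
    Z = walkCost z zs
    uₗ = walkEnd u us
    wₗ = walkEnd w ws
    zₗ = walkEnd z zs
    t₁ = realise enum (doubling₁ u us w ws z zs)
    t₂ = realise enum (doubling₂ u us w ws z zs)
    h = heavyEdge u (P (suc zero)) (tabulate (λ t → P (suc (suc t))))
    open HeavyEdge h
    e′ = g (walkEnd u before) v
    vₗ = walkEnd v after
    t₃ = realise (subst (λ l → Enumeration N ((u ∷ l) ++ (w ∷ ws) ++ (z ∷ zs))) split enum)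
                 (splitting u before v after w ws z zs)
    U≡ : U ≡ walkCost u before + e′ + walkCost v after
    U≡ = trans (cong (walkCost u) split) (walkCost-++ u before v after)
    uₗ≡ : uₗ ≡ vₗ
    uₗ≡ = trans (cong (walkEnd u) split) (walkEnd-++ u before v after)
    heavy-bound : inv1+ a * U ≤ e′
    heavy-bound = subst (λ n → inv1+ n * U ≤ e′) (ListP.length-tabulate (λ t → P (suc (suc t)))) (average≤heavyEdge h)
    doubling-sum : ∀ U W Z a b c d f h →
      (U + U + W + Z + d + b + h) + (U + U + W + Z + a + f + c) ≡
      ((U + W + Z + ½ * (a + b + c + d + f + h)) + (U + W + Z + ½ * (a + b + c + d + f + h))) + (U + U)
    doubling-sum = solve-∀ ℚ-ring
    saving : ∀ P₁ e P₂ W Z a b c d →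
      (P₁ + P₁ + P₂ + P₂ + W + Z + a + b + c + d) + (e + e) ≡
      (P₁ + e + P₂) + (P₁ + e + P₂) + W + Z + a + b + c + d
    saving = solve-∀ ℚ-ring

  cheapestTour : ∀ {i j k} (P : Fin (suc (suc i)) → Fin N) (Q : Fin (suc (suc j)) → Fin N) (R : Fin (suc (suc k)) → Fin N) →
    Enumeration N (tabulate P ++ tabulate Q ++ tabulate R) →
    Σ (HamiltonianCycle N) λ H → tourCost c H ≤ bound i j k * lpValue P Q R
  cheapestTour {i} {j} {k} P Q R enum =
    best , averaging i j k {T} {lpValue P Q R} {splitTourBound P Q R} {splitTourBound Q R P} {splitTourBound R P Q}
                           (weighted ρ₁ T lower₁)
                           (subst (λ l → T + inv1+ j * (T + T) ≤ splitTourBound Q R P + inv1+ j * (l + l))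
                                  (lpValue-rotate P Q R) (weighted ρ₂ T lower₂))
                           (subst (λ l → T + inv1+ k * (T + T) ≤ splitTourBound R P Q + inv1+ k * (l + l))
                                  (trans (lpValue-rotate Q R P) (lpValue-rotate P Q R)) (weighted ρ₃ T lower₃))
                           (splitTourBound-sum P Q R)
    where
    open Rotation
    ρ₁ = rotation P Q R enum
    enum′ = Enumeration-rotate (tabulate P) (tabulate Q) (tabulate R) enum
    ρ₂ = rotation Q R P enum′
    ρ₃ = rotation R P Q (Enumeration-rotate (tabulate Q) (tabulate R) (tabulate P) enum′)
    best : HamiltonianCycle N
    best = argmin (tourCost c) identityCycle (tours ρ₁ ++ tours ρ₂ ++ tours ρ₃)
    T : ℚ
    T = tourCost c best
    Lower : List (HamiltonianCycle N) → Set
    Lower = All (λ H → T ≤ tourCost c H)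
    lower : Lower (tours ρ₁ ++ tours ρ₂ ++ tours ρ₃)
    lower = f[argmin]≤f[xs] {f = tourCost c} identityCycle (tours ρ₁ ++ tours ρ₂ ++ tours ρ₃)
    lower₁ : Lower (tours ρ₁)
    lower₁ = proj₁ (AllP.++⁻ (tours ρ₁) lower)
    lower₂ : Lower (tours ρ₂)
    lower₂ = proj₁ (AllP.++⁻ (tours ρ₂) (proj₂ (AllP.++⁻ (tours ρ₁) lower)))
    lower₃ : Lower (tours ρ₃)
    lower₃ = proj₂ (AllP.++⁻ (tours ρ₂) (proj₂ (AllP.++⁻ (tours ρ₁) lower)))

mainTheorem7 : (i j k : ℕ) → (c : Fin (i ℕ.+ j ℕ.+ k ℕ.+ 6) → Fin (i ℕ.+ j ℕ.+ k ℕ.+ 6) → ℚ) →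
    IsMetricCost (i ℕ.+ j ℕ.+ k ℕ.+ 6) c →
    (x : Fin (i ℕ.+ j ℕ.+ k ℕ.+ 6) → Fin (i ℕ.+ j ℕ.+ k ℕ.+ 6) → ℚ) →
    SubtourOptimal (i ℕ.+ j ℕ.+ k ℕ.+ 6) c x →
    IsomorphicToXijk x i j k →
    0ℚ < linCost c x →
    ∃ λ (H : HamiltonianCycle (i ℕ.+ j ℕ.+ k ℕ.+ 6)) → tourCost c H ≤ bound i j k * linCost c x
mainTheorem7 i j k c metric x optimal (φ , iso) _ =
  proj₁ best , subst (λ l → tourCost c (proj₁ best) ≤ bound i j k * l) (sym linCost≡) (proj₂ best)
  where
  open Vertices i j k
  open Placement φ
  linCost≡ = linCost≡lpValue c x (IsMetricCost.symmetric metric)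
               (SubtourFeasible.symmetric (SubtourOptimal.feasible optimal)) iso
  best = TSPInstance.cheapestTour metric 2≤N (ψ ∘ X) (ψ ∘ Y) (ψ ∘ Z) enumeration
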